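{- For every integer $t\ge 2$, every convex polygon whose vertices are points of $S_t$ has at most $t-1$ vertices.
   Context: For integers $r\ge 1$ let $\delta_r:=3\cdot 4^{r-1}$ and $\delta_r':=(3r+1)\cdot 4^{r-1}$. For positive integers $k,l$ define $S_{k,l}\subset\mathbb{Z}^2$ recursively: $S_{k,l}:=\{(0,0)\}$ if $k\le 2$ or $l\le 2$; otherwise $S_{k,l}:=S_{k-1,l}\cup\{(x+\delta_{k+l-1},\,y+\delta_{k+l-1}'):(x,y)\in S_{k,l-1}\}$. Let $t\ge 2$ be an integer. For $0\le i\le t-3$ define $v_i:=(3(t-i),-3i)$, and let $w_0:=(0,0)$, $w_{i+1}:=w_i+v_i$ for $i=0,\dots,t-3$. For $i=0,\dots,t-2$ let $q_i:=(t+1)4^{t+1}w_i$. Define $S_t:=\bigcup_{i=0}^{t-2}\{p+q_i: p\in S_{t-i,i+2}\}$. -}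

module Defs where

open import Data.Fin using (Fin; toℕ)
open import Data.Fin.Properties using (nonZeroIndex)
open import Data.Integer using (ℤ; +_; -_; _+_; _-_; _*_; _<_; 0ℤ)
open import Data.Nat as ℕ using (ℕ; zero; suc; _∸_; _^_)
open import Data.Nat.DivMod using (_mod_)
open import Data.Product using (_×_; _,_; ∃-syntax)
open import Data.Sum using (_⊎_)
open import Function.Definitions using (Injective)
open import Level using (0ℓ)
open import Relation.Binary.PropositionalEquality using (_≡_; _≢_)
open import Relation.Unary using (Pred; ｛_｝; _∪_)

Point : Set
Point = ℤ × ℤ

infixl 6 _⊕_
infixl 7 _⊙_

origin : Point
origin = 0ℤ , 0ℤ

_⊕_ : Point → Point → Point
(x₁ , y₁) ⊕ (x₂ , y₂) = x₁ + x₂ , y₁ + y₂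

_⊙_ : ℤ → Point → Point
c ⊙ (x , y) = c * x , c * y

translate : Point → Pred Point 0ℓ → Pred Point 0ℓ
translate d A p = ∃[ a ] A a × p ≡ a ⊕ d

-- Meaningful for r ≥ 1 only; S below uses them at r ≥ 5.
δ δ′ : ℕ → ℕ
δ  r = 3 ℕ.* 4 ^ (r ∸ 1)
δ′ r = (3 ℕ.* r ℕ.+ 1) ℕ.* 4 ^ (r ∸ 1)

-- The first six clauses are the case k ≤ 2 or l ≤ 2.  The values at k = 0 or
-- l = 0 are never used: the indices of interest are positive.
S : ℕ → ℕ → Pred Point 0ℓ
S 0 l = ｛ origin ｝
S 1 l = ｛ origin ｝
S 2 l = ｛ origin ｝
S (suc (suc (suc _))) 0 = ｛ origin ｝
S (suc (suc (suc _))) 1 = ｛ origin ｝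
S (suc (suc (suc _))) 2 = ｛ origin ｝
S k@(suc k-1@(suc (suc _))) l@(suc l-1@(suc (suc _))) =
  S k-1 l ∪ translate (+ δ r , + δ′ r) (S k l-1)
  where
  r : ℕ
  r = k ℕ.+ l ∸ 1

v : ℕ → ℕ → Point
v t i = + 3 * (+ t - + i) , - (+ 3 * + i)

-- Defined for every i, but only i ≤ t - 2 matters.
w : ℕ → ℕ → Point
w t zero    = origin
w t (suc i) = w t i ⊕ v t i

q : ℕ → ℕ → Point
q t i = + ((t ℕ.+ 1) ℕ.* 4 ^ (t ℕ.+ 1)) ⊙ w t i

ErdősSzekeresSet : ℕ → Pred Point 0ℓ
ErdősSzekeresSet t p =
  ∃[ i ] i ℕ.≤ t ∸ 2 × translate (q t i) (S (t ∸ i) (i ℕ.+ 2)) p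

-- Twice the signed area of the triangle a b c: positive, zero or negative
-- according to whether c is to the left of, on, or to the right of the line
-- directed from a to b.
orient : Point → Point → Point → ℤ
orient (a₁ , a₂) (b₁ , b₂) (c₁ , c₂) =
  (b₁ - a₁) * (c₂ - a₂) - (b₂ - a₂) * (c₁ - a₁)

-- Cyclic successor: i ↦ i + 1 mod n.
next : ∀ {n} → Fin n → Fin n
next {n} i = _mod_ (suc (toℕ i)) n {{nonZeroIndex i}}

-- P lists the vertices of a convex polygon in cyclic order (clockwise or
-- counterclockwise).  The polygon is convex when, for each edge, all the other
-- vertices are on the same side of the line through it; strictness says that
-- the angle at each vertex is not straight, so that it is a genuine vertex.
-- For n ≥ 3 these are the usual convex n-gons; points (n = 1) and segments
-- (n = 2) are included as degenerate polygons.
record IsConvexPolygon {n : ℕ} (P : Fin n → Point) : Set where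
  field
    distinct : Injective _≡_ _≡_ P
    convex   : ∀ i →
      (∀ j → j ≢ i → j ≢ next i → 0ℤ < orient (P i) (P (next i)) (P j)) ⊎
      (∀ j → j ≢ i → j ≢ next i → orient (P i) (P (next i)) (P j) < 0ℤ)

{-# OPTIONS --safe #-}

-- Call a set A separated from B when every line through two points of A has
-- all of B on one side, and vice versa, the sides depending only on the order
-- of x-coordinates.  Seen from a vertex in B, the vertices of a convex polygon
-- lying in A then form a cup (or always a cap), and those in B form a cap
-- (or cup), so a polygon meeting both sets has at most as many vertices as the
-- longest cup of A and the longest cap of B together.
--
-- With s = k + l - 1, slopes between the two parts of S k l lie strictly between
-- s and s + 1, and slopes inside each part are below s; so the parts are separated,
-- and S k l has cups of at most k - 1 points, caps of at most l - 1 points and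
-- polygons of at most k + l - 3 points.  The translates of S (t - i) (i + 2)
-- are placed along a flat cap, slopes between different blocks being below 1
-- and slopes inside a block above 1.  Hence block j + 1 is separated from the
-- union of the blocks 0, …, j; by induction on j, caps in the latter have at
-- most j + 1 points, and polygons at most (j + 1) + (t - j - 2) = t - 1.

module Submission where

open import Defs
open import Data.Fin as Fin using (Fin; toℕ; fromℕ<; opposite)
import Data.Fin.Properties as Fin
open import Data.Integer as ℤ using (ℤ; +_; -_; _+_; _-_; _*_; 0ℤ; 1ℤ)
import Data.Integer.Properties as ℤ
open import Data.Integer.Tactic.RingSolver using (solve-∀)
open import Data.List using (List; []; _∷_; _++_; [_]; length; map; filter; tabulate)
import Data.List.Properties as List
open import Data.List.Membership.Propositional using (_∈_)
open import Data.List.Membership.Propositional.Properties using (∈-∃++)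
import Data.List.Relation.Binary.Permutation.Propositional.Properties as ↭
open import Data.List.Relation.Unary.All as All using (All; []; _∷_)
import Data.List.Relation.Unary.All.Properties as All
open import Data.List.Relation.Unary.AllPairs as AllPairs using (AllPairs; []; _∷_)
import Data.List.Relation.Unary.AllPairs.Properties as AllPairs
open import Data.List.Relation.Unary.Any using (here; there)
open import Data.Nat as ℕ using (ℕ; zero; suc; z≤n; s≤s; z<s; s<s; _≤_; _∸_; _^_)
import Data.Nat.DivMod as ℕ
import Data.Nat.Properties as ℕ
open import Data.Product using (_×_; _,_; ∃-syntax; ∃₂; proj₁; proj₂)
open import Data.Sum as Sum using (_⊎_; inj₁; inj₂; [_,_]′)
open import Function using (_∘_; flip; id)
open import Level using (0ℓ)
open import Relation.Binary using (Rel; Asymmetric; tri<; tri≈; tri>)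
open import Relation.Binary.PropositionalEquality hiding ([_])
open import Relation.Nullary using (¬_; contradiction; yes; no)
open import Relation.Unary using (Pred; Decidable; _⊆_; _∪_; ∁; ｛_｝)
open import Relation.Unary.Properties using (∁?)

-- Integer inequalities and the orientation of triples.

pos-+ : ∀ {i j} → 0ℤ ℤ.< i → 0ℤ ℤ.< j → 0ℤ ℤ.< i + j
pos-+ = ℤ.+-mono-<

pos-* : ∀ {i j} → 0ℤ ℤ.< i → 0ℤ ℤ.< j → 0ℤ ℤ.< i * j
pos-* {i} {j} 0<i 0<j = subst (ℤ._< i * j) (ℤ.*-zeroʳ i) (ℤ.*-monoˡ-<-pos i {{ℤ.positive 0<i}} 0<j)

*-cancel-pos : ∀ {i j} → 0ℤ ℤ.< i → 0ℤ ℤ.< i * j → 0ℤ ℤ.< j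
*-cancel-pos {i} {j} 0<i 0<ij =
  ℤ.*-cancelˡ-<-nonNeg i {{ℤ.nonNegative (ℤ.<⇒≤ 0<i)}} (subst (ℤ._< i * j) (sym (ℤ.*-zeroʳ i)) 0<ij)

<⇒pos : ∀ {i j} → i ℤ.< j → 0ℤ ℤ.< j - i
<⇒pos {i} {j} i<j = subst (ℤ._< j - i) (ℤ.+-inverseʳ i) (ℤ.+-monoˡ-< (- i) i<j)

pos⇒< : ∀ {i j} → 0ℤ ℤ.< j - i → i ℤ.< j
pos⇒< {i} {j} 0<j-i = subst₂ ℤ._<_ (ℤ.+-identityˡ i) (cancel i j) (ℤ.+-monoˡ-< i 0<j-i)
  where
  cancel : ∀ i j → j - i + i ≡ j
  cancel = solve-∀

-- A record rather than the bare inequality, so that the three points stay inferable: `orient`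
-- unfolds once its arguments are pairs.
record Left (a b c : Point) : Set where
  constructor mkLeft
  field orient-pos : 0ℤ ℤ.< orient a b c

orient-cyclic : ∀ a b c → orient a b c ≡ orient b c a
orient-cyclic (a , a′) (b , b′) (c , c′) = identity a a′ b b′ c c′
  where
  identity : ∀ a a′ b b′ c c′ →
    (b - a) * (c′ - a′) - (b′ - a′) * (c - a) ≡ (c - b) * (a′ - b′) - (c′ - b′) * (a - b)
  identity = solve-∀

orient-swap : ∀ a b c → orient b a c ≡ - orient a b c
orient-swap (a , a′) (b , b′) (c , c′) = identity a a′ b b′ c c′
  where
  identity : ∀ a a′ b b′ c c′ →
    (a - b) * (c′ - b′) - (a′ - b′) * (c - b) ≡ - ((b - a) * (c′ - a′) - (b′ - a′) * (c - a))
  identity = solve-∀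

orient-reverse : ∀ a b c → orient c b a ≡ - orient a b c
orient-reverse a b c = trans (orient-swap b c a) (cong -_ (sym (orient-cyclic a b c)))

-- The three-term Grassmann-Plücker relation for the vectors from `a` to the other four points. It
-- makes turns seen from `a` compose.
orient-plücker : ∀ a b c d e →
  orient a b d * orient a c e ≡ orient a b c * orient a d e + orient a c d * orient a b e
orient-plücker (a , a′) (b , b′) (c , c′) (d , d′) (e , e′) =
  identity (b - a) (b′ - a′) (c - a) (c′ - a′) (d - a) (d′ - a′) (e - a) (e′ - a′)
  where
  identity : ∀ b b′ c c′ d d′ e e′ →
    (b * d′ - b′ * d) * (c * e′ - c′ * e) ≡
    (b * c′ - b′ * c) * (d * e′ - d′ * e) + (c * d′ - c′ * d) * (b * e′ - b′ * e)
  identity = solve-∀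

orient-⊕ : ∀ d a b c → orient (a ⊕ d) (b ⊕ d) (c ⊕ d) ≡ orient a b c
orient-⊕ (d , d′) (a , a′) (b , b′) (c , c′) = identity a a′ b b′ c c′ d d′
  where
  identity : ∀ a a′ b b′ c c′ d d′ →
    (b + d - (a + d)) * (c′ + d′ - (a′ + d′)) - (b′ + d′ - (a′ + d′)) * (c + d - (a + d)) ≡
    (b - a) * (c′ - a′) - (b′ - a′) * (c - a)
  identity = solve-∀

orient-diagonal : ∀ a b → orient a b b ≡ 0ℤ
orient-diagonal (a , a′) (b , b′) = identity (b - a) (b′ - a′)
  where
  identity : ∀ x y → x * y - y * x ≡ 0ℤ
  identity = solve-∀

Left-cyclic : ∀ {a b c} → Left a b c → Left b c a
Left-cyclic {a} {b} {c} (mkLeft abc) = mkLeft (subst (0ℤ ℤ.<_) (orient-cyclic a b c) abc)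

Left-distinct : ∀ {a b c} → Left a b c → b ≢ c
Left-distinct {a} {b} (mkLeft abb) refl = ℤ.<-irrefl (sym (orient-diagonal a b)) abb

Left-asym : ∀ {a b c} → Left a b c → ¬ Left c b a
Left-asym {a} {b} {c} (mkLeft abc) (mkLeft cba) = ℤ.<-asym cba
  (subst (ℤ._< 0ℤ) (sym (orient-reverse a b c)) (ℤ.neg-mono-< abc))

-- Convex chains and polygons

-- All triples in list order count, not only consecutive ones, so every sublist inherits the
-- property.
data CCW : List Point → Set where
  []  : CCW []
  _∷_ : ∀ {a as} → AllPairs (Left a) as → CCW as → CCW (a ∷ as)

Chain : Rel Point 0ℓ → Pred (List Point) 0ℓ
Chain _≺_ L = AllPairs _≺_ L × CCW L

-- Distinctness is stated separately because `CCW` says nothing about lists of two points.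
Polygon : Pred (List Point) 0ℓ
Polygon L = AllPairs _≢_ L × CCW L

Bounded : Pred (List Point) 0ℓ → Pred Point 0ℓ → ℕ → Set
Bounded Q A m = ∀ {L} → All A L → Q L → length L ≤ m

AllPairs-++⁻ : ∀ {R : Rel Point 0ℓ} xs {ys} → AllPairs R (xs ++ ys) → AllPairs R xs × AllPairs R ys
AllPairs-++⁻ []       rs       = [] , rs
AllPairs-++⁻ (x ∷ xs) (r ∷ rs) with AllPairs-++⁻ xs rs
... | rsˣ , rsʸ = All.++⁻ˡ xs r ∷ rsˣ , rsʸ

CCW-++⁻ˡ : ∀ xs {ys} → CCW (xs ++ ys) → CCW xs
CCW-++⁻ˡ []       ccw        = []
CCW-++⁻ˡ (x ∷ xs) (ls ∷ ccw) = proj₁ (AllPairs-++⁻ xs ls) ∷ CCW-++⁻ˡ xs ccw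

CCW-filter : ∀ {P : Pred Point 0ℓ} (P? : Decidable P) {L} → CCW L → CCW (filter P? L)
CCW-filter P? []                = []
CCW-filter P? {a ∷ _} (ls ∷ ccw) with P? a
... | yes _ = AllPairs.filter⁺ P? ls ∷ CCW-filter P? ccw
... | no  _ = CCW-filter P? ccw

CCW-∷ʳ : ∀ {L z} → CCW L → AllPairs (λ a b → Left a b z) L → CCW (L ++ [ z ])
CCW-∷ʳ []         []       = [] ∷ []
CCW-∷ʳ (ls ∷ ccw) (m ∷ ms) =
  AllPairs.++⁺ ls ([] ∷ []) (All.map (λ left → left ∷ []) m) ∷ CCW-∷ʳ ccw ms

-- Moving the head to the end only permutes its triples cyclically, and `Left` is invariant under
-- that; this is repeated for each entry of `xs`.
CCW-rotate : ∀ xs {ys} → CCW (xs ++ ys) → CCW (ys ++ xs)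
CCW-rotate []       {ys} ccw        = subst CCW (sym (List.++-identityʳ ys)) ccw
CCW-rotate (x ∷ xs) {ys} (ls ∷ ccw) =
  subst CCW (List.++-assoc ys [ x ] xs)
    (CCW-rotate xs (subst CCW (List.++-assoc xs ys [ x ])
      (CCW-∷ʳ ccw (AllPairs.map Left-cyclic ls))))

CCW-map⁻ : ∀ d {L} → CCW (map (_⊕ d) L) → CCW L
CCW-map⁻ d {[]}    []         = []
CCW-map⁻ d {a ∷ L} (ls ∷ ccw) =
  AllPairs.map (λ {b} {c} (mkLeft abc) → mkLeft (subst (0ℤ ℤ.<_) (orient-⊕ d a b c) abc)) (AllPairs.map⁻ ls)
  ∷ CCW-map⁻ d ccw

length-filter-∁ : ∀ {P : Pred Point 0ℓ} (P? : Decidable P) L →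
  length (filter P? L) ℕ.+ length (filter (∁? P?) L) ≡ length L
length-filter-∁ P? []      = refl
length-filter-∁ P? (a ∷ L) with P? a
... | yes _ = cong suc (length-filter-∁ P? L)
... | no  _ = trans (ℕ.+-suc _ _) (cong suc (length-filter-∁ P? L))

-- Separated sets and bounds for their unions.

-- Every point of B lies on one fixed side of all lines through two points of
-- A, and vice versa, the sides being determined by ≺.
record Separated (_≺_ : Rel Point 0ℓ) (A B : Pred Point 0ℓ) : Set₁ where
  field
    side     : Pred Point 0ℓ
    side?    : Decidable side
    A⊆side   : A ⊆ side
    B⊆∁side  : B ⊆ ∁ side
    precedes : (∀ {a b} → A a → B b → a ≺ b) ⊎ (∀ {a b} → A a → B b → b ≺ a)
    connexA  : ∀ {a a′} → A a → A a′ → a ≢ a′ → a ≺ a′ ⊎ a′ ≺ a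
    connexB  : ∀ {b b′} → B b → B b′ → b ≢ b′ → b ≺ b′ ⊎ b′ ≺ b
    leftA    : ∀ {a a′ b} → A a → A a′ → B b → a ≺ a′ → Left a a′ b
    leftB    : ∀ {b b′ a} → B b → B b′ → A a → b′ ≺ b → Left b b′ a

-- Reversing the order exchanges the conditions `leftA` and `leftB`, so each result about one set
-- and one order also covers the other set with the opposite order.
Separated-flip : ∀ {_≺_ A B} → Separated _≺_ A B → Separated (flip _≺_) B A
Separated-flip sep = record
  { side     = ∁ side
  ; side?    = ∁? side?
  ; A⊆side   = B⊆∁side
  ; B⊆∁side  = λ Aa ¬side → ¬side (A⊆side Aa)
  ; precedes = Sum.map (λ f Bb Aa → f Aa Bb) (λ f Bb Aa → f Aa Bb) precedes
  ; connexA  = λ Bb Bb′ → Sum.swap ∘ connexB Bb Bb′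
  ; connexB  = λ Aa Aa′ → Sum.swap ∘ connexA Aa Aa′
  ; leftA    = leftB
  ; leftB    = leftA
  }
  where open Separated sep

-- Once an entry lies in `B`, no later one can lie in `A`: it would both precede and follow that
-- entry.
split-∪ : ∀ {_≺_ : Rel Point 0ℓ} {A B : Pred Point 0ℓ} → Asymmetric _≺_ →
  (∀ {a b} → A a → B b → a ≺ b) → ∀ {L} → All (A ∪ B) L → AllPairs _≺_ L →
  ∃₂ λ xs ys → L ≡ xs ++ ys × All A xs × All B ys
split-∪ asym A≺B []              []       = [] , [] , refl , [] , []
split-∪ asym A≺B (inj₁ Aa ∷ ABs) (_ ∷ ≺s) with split-∪ asym A≺B ABs ≺s
... | xs , ys , refl , As , Bs = _ ∷ xs , ys , refl , Aa ∷ As , Bs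
split-∪ asym A≺B (inj₂ Bb ∷ ABs) (b≺ ∷ _) =
  [] , _ , refl , [] , Bb ∷ All.zipWith
    (λ { (inj₁ Aa , b≺a) → contradiction b≺a (asym (A≺B Aa Bb)) ; (inj₂ Bb′ , _) → Bb′ }) (ABs , b≺)

-- A point of `A` followed by `b ≺ b′` in `B` would turn left, against `leftB`. So the list lies in
-- `B`, or it adds at most one point to a chain in `A`.
chain-++-bound : ∀ {_≺_ A B m} → Separated _≺_ A B →
  Bounded (Chain _≺_) A m → Bounded (Chain _≺_) B (suc m) →
  ∀ xs ys → All A xs → All B ys → AllPairs _≺_ xs → AllPairs _≺_ ys → CCW (xs ++ ys) →
  length (xs ++ ys) ≤ suc m
chain-++-bound sep boundA boundB []       ys            As Bs ≺x ≺y ccw = boundB Bs (≺y , ccw)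
chain-++-bound sep boundA boundB (a ∷ xs) []            As Bs ≺x ≺y ccw
  rewrite List.++-identityʳ xs = ℕ.m≤n⇒m≤1+n (boundA As (≺x , ccw))
chain-++-bound {m = m} sep boundA boundB (a ∷ xs) (b ∷ [])      As Bs ≺x ≺y ccw =
  subst (_≤ suc m) (sym (trans (List.length-++ (a ∷ xs)) (ℕ.+-comm _ 1)))
    (s≤s (boundA As (≺x , CCW-++⁻ˡ (a ∷ xs) ccw)))
chain-++-bound sep boundA boundB (a ∷ xs) (b ∷ b′ ∷ ys) (Aa ∷ _) (Bb ∷ Bb′ ∷ _) ≺x ((b≺b′ ∷ _) ∷ _) (ls ∷ _)
  with proj₂ (AllPairs-++⁻ xs ls)
... | (left ∷ _) ∷ _ = contradiction (Separated.leftB sep Bb′ Bb Aa b≺b′) (Left-asym left)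

chain-∪-bound : ∀ {_≺_ A B m} → Asymmetric _≺_ → Separated _≺_ A B →
  Bounded (Chain _≺_) A m → Bounded (Chain _≺_) B (suc m) → Bounded (Chain _≺_) (A ∪ B) (suc m)
chain-∪-bound asym sep boundA boundB ABs (≺s , ccw) with Separated.precedes sep
... | inj₁ A≺B with split-∪ asym A≺B ABs ≺s
...   | xs , ys , refl , As , Bs =
  chain-++-bound sep boundA boundB xs ys As Bs (proj₁ (AllPairs-++⁻ xs ≺s)) (proj₂ (AllPairs-++⁻ xs ≺s)) ccw
chain-∪-bound {m = m} asym sep boundA boundB ABs (≺s , ccw) | inj₂ B≺A
  with split-∪ asym (λ Bb Aa → B≺A Aa Bb) (All.map Sum.swap ABs) ≺s
... | ys , xs , refl , Bs , As =
  -- The points of `B` come first here. Rotation brings those of `A` to the front and keeps the left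
  -- turns, but not the order of the whole list; hence `chain-++-bound` asks only that each part be
  -- sorted.
  subst (_≤ suc m) (List.length-++-comm xs ys)
    (chain-++-bound sep boundA boundB xs ys As Bs (proj₂ (AllPairs-++⁻ ys ≺s)) (proj₁ (AllPairs-++⁻ ys ≺s))
      (CCW-rotate ys ccw))

-- From a vertex in B, the vertices in A are seen in the order of ≺.
polygon-side-chain : ∀ {_≺_ A B} (sep : Separated _≺_ A B) →
  ∀ {L b} → All (A ∪ B) L → CCW L → b ∈ L → B b →
  ∃[ K ] All A K × Chain _≺_ K × length K ≡ length (filter (Separated.side? sep) L)
polygon-side-chain {_≺_} {A} {B} sep {L} {b} ABs ccw b∈L Bb with ∈-∃++ b∈L
... | xs , ys , refl with CCW-rotate xs ccw
...   | ls ∷ ccw′ =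
  filter side? (ys ++ xs) , As , (order As (AllPairs.filter⁺ side? ls) , CCW-filter side? ccw′) , lengths
  where
  open Separated sep
  As : All A (filter side? (ys ++ xs))
  As = All.zipWith (λ { (_ , inj₁ Aa) → Aa ; (sideb , inj₂ Bb) → contradiction sideb (B⊆∁side Bb) })
    ( All.all-filter side? (ys ++ xs)
    , All.filter⁺ side? (All.++⁺ (All.tail (All.++⁻ʳ xs ABs)) (All.++⁻ˡ xs ABs)))
  order : ∀ {K} → All A K → AllPairs (Left b) K → AllPairs _≺_ K
  order []        []       = []
  order (Aa ∷ As) (m ∷ ms) = All.zipWith
    (λ (Aa′ , left) →
      [ id , (λ a′≺a → contradiction (leftA Aa′ Aa Bb a′≺a) (Left-asym left)) ]′
        (connexA Aa Aa′ (Left-distinct left)))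
    (As , m) ∷ order As ms
  lengths : length (filter side? (ys ++ xs)) ≡ length (filter side? (xs ++ b ∷ ys))
  lengths = trans (cong length (sym (List.filter-reject side? (B⊆∁side Bb))))
    (↭.↭-length (↭.filter-↭ side? (↭.++-comm (b ∷ ys) xs)))

all-or-some : ∀ {A B : Pred Point 0ℓ} {L} → All (A ∪ B) L → All A L ⊎ ∃[ b ] b ∈ L × B b
all-or-some [] = inj₁ []
all-or-some (inj₂ Bb ∷ _) = inj₂ (_ , here refl , Bb)
all-or-some (inj₁ Aa ∷ ABs) = Sum.map (Aa ∷_) (λ (b , b∈L , Bb) → b , there b∈L , Bb) (all-or-some ABs)

-- If both sets are met, a vertex in each shows the vertices in the other as a chain, and `side`
-- counts every vertex exactly once. Otherwise the polygon lies in one set.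
polygon-∪-bound : ∀ {_≺_ A B m n o} → Separated _≺_ A B →
  Bounded (Chain _≺_) A m → Bounded (Chain (flip _≺_)) B n → m ℕ.+ n ≤ o →
  Bounded Polygon A o → Bounded Polygon B o → Bounded Polygon (A ∪ B) o
polygon-∪-bound {o = o} sep chainA chainB m+n≤o polyA polyB {L} ABs poly@(_ , ccw) with all-or-some ABs
... | inj₁ As = polyA As poly
... | inj₂ (b , b∈L , Bb) with all-or-some (All.map Sum.swap ABs)
...   | inj₁ Bs = polyB Bs poly
...   | inj₂ (a , a∈L , Aa)
  with polygon-side-chain sep ABs ccw b∈L Bb
     | polygon-side-chain (Separated-flip sep) (All.map Sum.swap ABs) ccw a∈L Aa
... | K , As , chain , |K| | K′ , Bs , chain′ , |K′| =
  subst (_≤ o) (trans (cong₂ ℕ._+_ |K| |K′|) (length-filter-∁ (Separated.side? sep) L))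
    (ℕ.≤-trans (ℕ.+-mono-≤ (chainA As chain) (chainB Bs chain′)) m+n≤o)

-- Translates, cups and caps.

TranslationInvariant : Pred (List Point) 0ℓ → Set
TranslationInvariant Q = ∀ d {L} → Q (map (_⊕ d) L) → Q L

translate-list : ∀ {A d L} → All (translate d A) L → ∃[ K ] All A K × L ≡ map (_⊕ d) K
translate-list []                     = [] , [] , refl
translate-list ((a , Aa , refl) ∷ ts) with translate-list ts
... | K , As , refl = a ∷ K , Aa ∷ As , refl

Bounded-translate : ∀ {Q A m} d → TranslationInvariant Q → Bounded Q A m → Bounded Q (translate d A) m
Bounded-translate {m = m} d inv bound ts q with translate-list ts
... | K , As , refl = subst (_≤ m) (sym (List.length-map _ K)) (bound As (inv d q))

Bounded-⊆ : ∀ {Q A B m} → A ⊆ B → Bounded Q B m → Bounded Q A m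
Bounded-⊆ A⊆B bound As = bound (All.map A⊆B As)

Bounded-≤ : ∀ {Q A m n} → m ≤ n → Bounded Q A m → Bounded Q A n
Bounded-≤ m≤n bound As q = ℕ.≤-trans (bound As q) m≤n

Polygon-translation : TranslationInvariant Polygon
Polygon-translation d (≢s , ccw) = AllPairs.map (λ ne → ne ∘ cong (_⊕ d)) (AllPairs.map⁻ ≢s) , CCW-map⁻ d ccw

_<ˣ_ : Rel Point 0ℓ
a <ˣ b = proj₁ a ℤ.< proj₁ b

_>ˣ_ : Rel Point 0ℓ
_>ˣ_ = flip _<ˣ_

<ˣ-⊕⁻ : ∀ d {a b} → (a ⊕ d) <ˣ (b ⊕ d) → a <ˣ b
<ˣ-⊕⁻ (d , _) {a , _} {b , _} lt = pos⇒< (subst (0ℤ ℤ.<_) (cancel a b d) (<⇒pos lt))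
  where
  cancel : ∀ a b d → b + d - (a + d) ≡ b - a
  cancel = solve-∀

-- A cap read from right to left turns left, so cups and caps are the same kind of chain for
-- opposite orders.
Cup Cap : Pred (List Point) 0ℓ
Cup = Chain _<ˣ_
Cap = Chain _>ˣ_

Cup-translation : TranslationInvariant Cup
Cup-translation d (<s , ccw) = AllPairs.map (λ {a} {b} → <ˣ-⊕⁻ d {a} {b}) (AllPairs.map⁻ <s) , CCW-map⁻ d ccw

Cap-translation : TranslationInvariant Cap
Cap-translation d (>s , ccw) = AllPairs.map (λ {a} {b} → <ˣ-⊕⁻ d {b} {a}) (AllPairs.map⁻ >s) , CCW-map⁻ d ccw

Bounded-｛｝ : ∀ {R : Rel Point 0ℓ} {p m} → (∀ {a} → ¬ R a a) → Bounded (Chain R) ｛ p ｝ (suc m)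
Bounded-｛｝ irrefl {[]}        _                 _                   = z≤n
Bounded-｛｝ irrefl {_ ∷ []}    _                 _                   = s≤s z≤n
Bounded-｛｝ irrefl {_ ∷ _ ∷ _} (refl ∷ refl ∷ _) ((r ∷ _) ∷ _ , _) = contradiction r irrefl

-- Vertex order of a convex polygon

-- Angular order around `a` is transitive in the open half-plane to the left of the ray from `a` to
-- `e`: the Plücker relation writes `orient a e c * orient a b d` as a sum of two positive products.
Left-trans : ∀ {a e b c d} → Left a e b → Left a e c → Left a e d → Left a b c → Left a c d → Left a b d
Left-trans {a} {e} {b} {c} {d} (mkLeft aeb) (mkLeft aec) (mkLeft aed) (mkLeft abc) (mkLeft acd) =
  mkLeft (*-cancel-pos aec (subst (0ℤ ℤ.<_) (sym (orient-plücker a e b c d))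
    (pos-+ (pos-* aeb acd) (pos-* abc aed))))

-- With a right turn coded as a left turn read backwards, a clockwise polygon becomes `CCW` when its
-- vertices are listed in reverse.
Right : Point → Point → Point → Set
Right a b c = Left c b a

Right-trans : ∀ {a e b c d} → Right a e b → Right a e c → Right a e d → Right a b c → Right a c d → Right a b d
Right-trans {a} {e} {b} {c} {d} aeb aec aed abc acd =
  Left-cyclic {a} {d} {b} (mkLeft (*-cancel-pos {orient a c e} (positive aec) (subst (0ℤ ℤ.<_) identity
    (pos-+ (pos-* {orient a d c} (positive acd) (positive aeb))
           (pos-* {orient a c b} (positive abc) (positive aed))))))
  where
  positive : ∀ {b c} → Right a b c → 0ℤ ℤ.< orient a c b
  positive cba = Left.orient-pos (Left-cyclic (Left-cyclic cba))
  identity : orient a d c * orient a b e + orient a c b * orient a d e ≡ orient a c e * orient a d b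
  identity = trans (sym (orient-plücker a d c b e)) (ℤ.*-comm (orient a d b) (orient a c e))

Consecutive : ∀ {n} → Fin n → Fin n → Set
Consecutive i j = toℕ j ≡ suc (toℕ i)

<⇒≢ : ∀ {n} {i j : Fin n} → i Fin.< j → i ≢ j
<⇒≢ i<j refl = ℕ.<-irrefl refl i<j

next-consecutive : ∀ {n} {i j : Fin n} → Consecutive i j → next i ≡ j
next-consecutive {suc n} {i} {j} eq = Fin.toℕ-injective (trans (Fin.toℕ-fromℕ< _)
  (trans (ℕ.m<n⇒m%n≡m (subst (ℕ._< suc n) eq (Fin.toℕ<n j))) (sym eq)))

Edge : (Point → Point → Point → Set) → ∀ {n} → (Fin n → Point) → Fin n → Fin n → Set
Edge T P i j = ∀ k → k ≢ i → k ≢ j → T (P i) (P j) (P k)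

-- `T` stands for `Left` or `Right`, so that both orientations share one argument.
module _ (T : Point → Point → Point → Set)
  (T-cyclic : ∀ {a b c} → T a b c → T b c a)
  (T-trans : ∀ {a e b c d} → T a e b → T a e c → T a e d → T a b c → T a c d → T a b d)
  {n} (P : Fin n → Point) (edge : ∀ {i j} → Consecutive i j → Edge T P i j)
  where

  -- Seen from P i, all vertices lie on one side of the edge leaving P i, so
  -- the turns at consecutive vertices k′, k compose.
  edges⇒triples : ∀ m {i j k} → i Fin.< j → toℕ k ≡ suc m ℕ.+ toℕ j → T (P i) (P j) (P k)
  edges⇒triples zero {i} {j} {k} i<j eq =
    T-cyclic (T-cyclic (edge eq i (<⇒≢ i<j) (<⇒≢ (ℕ.<-trans i<j (ℕ.≤-reflexive (sym eq))))))
  edges⇒triples (suc m) {i} {j} {k} i<j eq with suc (toℕ i) ℕ.≟ toℕ j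
  ... | yes adjacent = edge (sym adjacent) k (<⇒≢ (ℕ.<-trans i<j j<k) ∘ sym) (<⇒≢ j<k ∘ sym)
    where
    j<k : j Fin.< k
    j<k = subst (suc (toℕ j) ≤_) (sym eq) (s≤s (ℕ.m≤n+m (toℕ j) (suc m)))
  ... | no ¬adjacent =
    T-trans (edge i→e j (>i i<j) (>e e<j)) (edge i→e k′ (>i (ℕ.<-trans i<j j<k′)) (>e (ℕ.<-trans e<j j<k′)))
      (edge i→e k (>i (ℕ.<-trans i<j j<k)) (>e (ℕ.<-trans e<j j<k)))
      (edges⇒triples m i<j k′≡)
      (T-cyclic (T-cyclic (edge k′→k i (<⇒≢ (ℕ.<-trans i<j j<k′)) (<⇒≢ (ℕ.<-trans i<j j<k)))))
    where
    k′ e : Fin n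
    k′ = fromℕ< {suc m ℕ.+ toℕ j} (ℕ.<-trans (ℕ.≤-reflexive (sym eq)) (Fin.toℕ<n k))
    e = fromℕ< {suc (toℕ i)} (ℕ.≤-<-trans i<j (Fin.toℕ<n j))
    k′≡ : toℕ k′ ≡ suc m ℕ.+ toℕ j
    k′≡ = Fin.toℕ-fromℕ< _
    i→e : Consecutive i e
    i→e = Fin.toℕ-fromℕ< _
    k′→k : Consecutive k′ k
    k′→k = trans eq (cong suc (sym k′≡))
    j<k′ : j Fin.< k′
    j<k′ = subst (suc (toℕ j) ≤_) (sym k′≡) (s≤s (ℕ.m≤n+m (toℕ j) m))
    j<k : j Fin.< k
    j<k = ℕ.<-trans j<k′ (ℕ.≤-reflexive (sym k′→k))
    e<j : e Fin.< j
    e<j = subst (ℕ._< toℕ j) (sym i→e) (ℕ.≤∧≢⇒< i<j ¬adjacent)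
    >i : ∀ {l} → i Fin.< l → l ≢ i
    >i i<l = <⇒≢ i<l ∘ sym
    >e : ∀ {l} → e Fin.< l → l ≢ e
    >e e<l = <⇒≢ e<l ∘ sym

  edges⇒turns : ∀ {i j k} → i Fin.< j → j Fin.< k → T (P i) (P j) (P k)
  edges⇒turns {i} {j} {k} i<j j<k = edges⇒triples (toℕ k ∸ suc (toℕ j)) i<j
    (trans (sym (ℕ.m∸n+n≡m j<k)) (ℕ.+-suc (toℕ k ∸ suc (toℕ j)) (toℕ j)))

tabulate-CCW : ∀ {n} {P : Fin n → Point} →
  (∀ {i j k} → i Fin.< j → j Fin.< k → Left (P i) (P j) (P k)) →
  CCW (tabulate P)
tabulate-CCW {zero}  turns = []
tabulate-CCW {suc n} turns =
  AllPairs.tabulate⁺-< (λ i<j → turns z<s (s<s i<j)) ∷ tabulate-CCW (λ i<j j<k → turns (s<s i<j) (s<s j<k))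

opposite-< : ∀ {n} {i j : Fin n} → i Fin.< j → opposite j Fin.< opposite i
opposite-< {n} {i} {j} i<j = subst₂ ℕ._<_ (sym (Fin.opposite-prop j)) (sym (Fin.opposite-prop i))
  (ℕ.∸-monoʳ-< (s<s i<j) (Fin.toℕ<n j))

opposite-injective : ∀ {n} {i j : Fin n} → opposite i ≡ opposite j → i ≡ j
opposite-injective {i = i} {j} eq =
  trans (sym (Fin.opposite-involutive i)) (trans (cong opposite eq) (Fin.opposite-involutive j))

module _ {n} {P : Fin n → Point} (polygon : IsConvexPolygon P) where
  open IsConvexPolygon polygon

  edge-side : ∀ {i j} → Consecutive i j → Edge Left P i j ⊎ Edge Right P i j
  edge-side {i} {j} i→j with next i | next-consecutive {i = i} {j} i→j | convex i
  ... | _ | refl | inj₁ pos = inj₁ λ k k≢i k≢j → mkLeft (pos k k≢i k≢j)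
  ... | _ | refl | inj₂ neg = inj₂ λ k k≢i k≢j →
    mkLeft (subst (0ℤ ℤ.<_) (sym (orient-reverse (P i) (P j) (P k))) (ℤ.neg-mono-< (neg k k≢i k≢j)))

  module _ {T T′ : Point → Point → Point → Set}
    (T-cyclic : ∀ {a b c} → T a b c → T b c a)
    (T-excludes : ∀ {a b c} → T a b c → ¬ T′ a b c)
    (side : ∀ {i j} → Consecutive i j → Edge T P i j ⊎ Edge T′ P i j)
    where

    -- The triangle on three consecutive vertices `h`, `i`, `j` tests both the edge from `h` to `i`
    -- and the edge from `i` to `j`, so neighbouring edges cannot disagree. The induction starts at
    -- vertex 0.
    edge-propagate : (∀ {i j} → toℕ i ≡ 0 → Consecutive i j → Edge T P i j) →
      ∀ m {i j} → toℕ i ≡ m → Consecutive i j → Edge T P i j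
    edge-propagate base zero    i≡0  i→j = base i≡0 i→j
    edge-propagate base (suc m) {i} {j} i≡m+1 i→j with side i→j
    ... | inj₁ edge = edge
    ... | inj₂ edge = contradiction (edge h (<⇒≢ h<i) (<⇒≢ h<j))
            (T-excludes (T-cyclic (edge-propagate base m h≡m h→i j (<⇒≢ h<j ∘ sym) (<⇒≢ i<j ∘ sym))))
      where
      h : Fin n
      h = fromℕ< {m} (ℕ.<-trans (ℕ.≤-reflexive (sym i≡m+1)) (Fin.toℕ<n i))
      h≡m : toℕ h ≡ m
      h≡m = Fin.toℕ-fromℕ< _
      h→i : Consecutive h i
      h→i = trans i≡m+1 (cong suc (sym h≡m))
      h<i : h Fin.< i
      h<i = ℕ.≤-reflexive (sym h→i)
      i<j : i Fin.< j
      i<j = ℕ.≤-reflexive (sym i→j)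
      h<j : h Fin.< j
      h<j = ℕ.<-trans h<i i<j

  first-edge : ∀ {T i₀ j₀} → toℕ i₀ ≡ 0 → Consecutive i₀ j₀ → Edge T P i₀ j₀ →
    ∀ {i j} → toℕ i ≡ 0 → Consecutive i j → Edge T P i j
  first-edge {T} i₀≡0 i₀→j₀ edge i≡0 i→j =
    subst₂ (Edge T P) (Fin.toℕ-injective (trans i₀≡0 (sym i≡0)))
      (Fin.toℕ-injective (trans i₀→j₀ (trans (cong suc (trans i₀≡0 (sym i≡0))) (sym i→j)))) edge

  edges-agree : (∀ {i j} → Consecutive i j → Edge Left P i j) ⊎ (∀ {i j} → Consecutive i j → Edge Right P i j)
  edges-agree with 2 ℕ.≤? n
  ... | no 2≰n = inj₁ λ {i} {j} i→j →
    contradiction (ℕ.≤-trans (s≤s (subst (1 ≤_) (sym i→j) (s≤s z≤n))) (Fin.toℕ<n j)) 2≰n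
  ... | yes 2≤n = Sum.map
    (λ edge {i} {j} → edge-propagate {Left} {Right} Left-cyclic Left-asym
      edge-side (first-edge {Left} i₀≡0 i₀→j₀ edge) _ {i} {j} refl)
    (λ edge {i} {j} → edge-propagate {Right} {Left} (λ r → Left-cyclic (Left-cyclic r)) (λ r l → Left-asym l r)
      (λ {i} {j} i→j → Sum.swap (edge-side {i} {j} i→j)) (first-edge {Right} i₀≡0 i₀→j₀ edge) _ {i} {j} refl)
    (edge-side i₀→j₀)
    where
    i₀ j₀ : Fin n
    i₀ = fromℕ< {0} (ℕ.<⇒≤ 2≤n)
    j₀ = fromℕ< {1} 2≤n
    i₀≡0 : toℕ i₀ ≡ 0
    i₀≡0 = Fin.toℕ-fromℕ< _
    i₀→j₀ : Consecutive i₀ j₀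
    i₀→j₀ = trans (Fin.toℕ-fromℕ< 2≤n) (cong suc (sym i₀≡0))

  polygon-list : ∃[ L ] Polygon L × length L ≡ n × (∀ {A : Pred Point 0ℓ} → (∀ i → A (P i)) → All A L)
  polygon-list with edges-agree
  ... | inj₁ edges =
    tabulate P
    , (AllPairs.tabulate⁺ (λ i≢j → i≢j ∘ distinct)
      , tabulate-CCW (edges⇒turns Left Left-cyclic Left-trans P edges))
    , List.length-tabulate P
    , All.tabulate⁺
  ... | inj₂ edges =
    tabulate (P ∘ opposite)
    , (AllPairs.tabulate⁺ (λ i≢j → i≢j ∘ opposite-injective ∘ distinct)
      , tabulate-CCW (λ i<j j<k →
          edges⇒turns Right (λ r → Left-cyclic (Left-cyclic r)) Right-trans P edges
            (opposite-< j<k) (opposite-< i<j)))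
    , List.length-tabulate (P ∘ opposite)
    , λ AP → All.tabulate⁺ (AP ∘ opposite)

pos-+-nonneg : ∀ {i j} → 0ℤ ℤ.< i → 0ℤ ℤ.≤ j → 0ℤ ℤ.< i + j
pos-+-nonneg = ℤ.+-mono-<-≤

nonneg-+ : ∀ {i j} → 0ℤ ℤ.≤ i → 0ℤ ℤ.≤ j → 0ℤ ℤ.≤ i + j
nonneg-+ = ℤ.+-mono-≤

nonneg-* : ∀ {i j} → 0ℤ ℤ.≤ i → 0ℤ ℤ.≤ j → 0ℤ ℤ.≤ i * j
nonneg-* {i} {j} 0≤i 0≤j =
  subst (ℤ._≤ i * j) (ℤ.*-zeroʳ i) (ℤ.*-monoˡ-≤-nonNeg i {{ℤ.nonNegative 0≤i}} 0≤j)

-- Slopes in S k l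

Δx Δy : Point → Point → ℤ
Δx a b = proj₁ b - proj₁ a
Δy a b = proj₂ b - proj₂ a

-- The slope inequality with its denominator `Δx a b` cleared; positivity of `Δx a b` keeps the
-- direction of the inequality.
record SlopeAbove (c : ℤ) (a b : Point) : Set where
  constructor mkAbove
  field
    Δx-pos : 0ℤ ℤ.< Δx a b
    excess : 0ℤ ℤ.< Δy a b - c * Δx a b

record SlopeBelow (c : ℤ) (a b : Point) : Set where
  constructor mkBelow
  field
    Δx-pos  : 0ℤ ℤ.< Δx a b
    deficit : 0ℤ ℤ.< c * Δx a b - Δy a b

-- The slope rises past `c` at `b`; `orient` is the sum of each `Δx` times the excess or deficit of
-- the other segment.
left-turn : ∀ {c a b d} → SlopeBelow c a b → SlopeAbove c b d → Left a b d
left-turn {c} {a , a′} {b , b′} {d , d′} (mkBelow ab ab<c) (mkAbove bd c<bd) =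
  mkLeft (subst (0ℤ ℤ.<_) (identity a a′ b b′ d d′ c) (pos-+ (pos-* ab c<bd) (pos-* bd ab<c)))
  where
  identity : ∀ a a′ b b′ d d′ c →
    (b - a) * (d′ - b′ - c * (d - b)) + (d - b) * (c * (b - a) - (b′ - a′)) ≡
    (b - a) * (d′ - a′) - (b′ - a′) * (d - a)
  identity = solve-∀

right-turn : ∀ {c a b d} → SlopeAbove c a b → SlopeBelow c b d → Left d b a
right-turn {c} {a , a′} {b , b′} {d , d′} (mkAbove ab c<ab) (mkBelow bd bd<c) =
  mkLeft (subst (0ℤ ℤ.<_) (identity a a′ b b′ d d′ c) (pos-+ (pos-* bd c<ab) (pos-* ab bd<c)))
  where
  identity : ∀ a a′ b b′ d d′ c →
    (d - b) * (b′ - a′ - c * (b - a)) + (b - a) * (c * (d - b) - (d′ - b′)) ≡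
    (b - d) * (a′ - d′) - (b′ - d′) * (a - d)
  identity = solve-∀

SlopeBelow-suc : ∀ {c a b} → SlopeBelow c a b → SlopeBelow (1ℤ + c) a b
SlopeBelow-suc {c} {a} {b} (mkBelow ab ab<c) =
  mkBelow ab (subst (0ℤ ℤ.<_) (identity c (Δx a b) (Δy a b)) (pos-+ ab<c ab))
  where
  identity : ∀ c x y → c * x - y + x ≡ (1ℤ + c) * x - y
  identity = solve-∀

cancel-⊕ : ∀ a b d → b - a ≡ b + d - (a + d)
cancel-⊕ = solve-∀

SlopeAbove-⊕ : ∀ {c a b} d → SlopeAbove c a b → SlopeAbove c (a ⊕ d) (b ⊕ d)
SlopeAbove-⊕ {c} {a , a′} {b , b′} (d , d′) (mkAbove ab c<ab) = mkAbove
  (subst (0ℤ ℤ.<_) (cancel-⊕ a b d) ab)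
  (subst₂ (λ x y → 0ℤ ℤ.< y - c * x) (cancel-⊕ a b d) (cancel-⊕ a′ b′ d′) c<ab)

SlopeBelow-⊕ : ∀ {c a b} d → SlopeBelow c a b → SlopeBelow c (a ⊕ d) (b ⊕ d)
SlopeBelow-⊕ {c} {a , a′} {b , b′} (d , d′) (mkBelow ab ab<c) = mkBelow
  (subst (0ℤ ℤ.<_) (cancel-⊕ a b d) ab)
  (subst₂ (λ x y → 0ℤ ℤ.< c * x - y) (cancel-⊕ a b d) (cancel-⊕ a′ b′ d′) ab<c)

-- The lower bound 1 serves the arrangement of the blocks, the upper bound `c` the recursion for
-- `S`.
Steep : ℤ → Point → Point → Set
Steep c a b = SlopeAbove 1ℤ a b × SlopeBelow c a b

Comparable : ℤ → Pred Point 0ℓ → Set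
Comparable c A = ∀ {a b} → A a → A b → a ≡ b ⊎ Steep c a b ⊎ Steep c b a

Comparable-translate : ∀ {c A} d → Comparable c A → Comparable c (translate d A)
Comparable-translate d cmp (a , Aa , refl) (b , Ab , refl) =
  Sum.map (cong (_⊕ d)) (Sum.map steep steep) (cmp Aa Ab)
  where
  steep : ∀ {c a b} → Steep c a b → Steep c (a ⊕ d) (b ⊕ d)
  steep (above , below) = SlopeAbove-⊕ d above , SlopeBelow-⊕ d below

Comparable-suc : ∀ {c A} → Comparable c A → Comparable (1ℤ + c) A
Comparable-suc cmp Aa Ab = Sum.map₂ (Sum.map steep steep) (cmp Aa Ab)
  where
  steep : ∀ {c a b} → Steep c a b → Steep (1ℤ + c) a b
  steep (above , below) = above , SlopeBelow-suc below

Comparable-∪ : ∀ {c A B} → Comparable c A → Comparable c B →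
  (∀ {a b} → A a → B b → Steep c a b) → Comparable c (A ∪ B)
Comparable-∪ cmpA cmpB cross (inj₁ Aa) (inj₁ Aa′) = cmpA Aa Aa′
Comparable-∪ cmpA cmpB cross (inj₁ Aa) (inj₂ Bb)  = inj₂ (inj₁ (cross Aa Bb))
Comparable-∪ cmpA cmpB cross (inj₂ Bb) (inj₁ Aa)  = inj₂ (inj₂ (cross Aa Bb))
Comparable-∪ cmpA cmpB cross (inj₂ Bb) (inj₂ Bb′) = cmpB Bb Bb′

SlopeAbove⇒<ˣ : ∀ {c a b} → SlopeAbove c a b → a <ˣ b
SlopeAbove⇒<ˣ (mkAbove ab _) = pos⇒< ab

comparable-connex : ∀ {c A a b} → Comparable c A → A a → A b → a ≢ b → a <ˣ b ⊎ b <ˣ a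
comparable-connex {a = a} {b} cmp Aa Ab a≢b with cmp Aa Ab
... | inj₁ a≡b            = contradiction a≡b a≢b
... | inj₂ (inj₁ (ab , _)) = inj₁ (SlopeAbove⇒<ˣ ab)
... | inj₂ (inj₂ (ba , _)) = inj₂ (SlopeAbove⇒<ˣ ba)

comparable-steep : ∀ {c A a b} → Comparable c A → A a → A b → a <ˣ b → Steep c a b
comparable-steep cmp Aa Ab a<b with cmp Aa Ab
... | inj₁ refl            = contradiction a<b (ℤ.<-irrefl refl)
... | inj₂ (inj₁ steep)    = steep
... | inj₂ (inj₂ (ba , _)) = contradiction a<b (ℤ.<-asym (SlopeAbove⇒<ˣ ba))

-- Boxes around the sets `S k l`.

-- With N = 4 ^ ρ, S k l lies in Box ρ N for ρ = k + l - 1.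
record Box (ρ N : ℤ) (p : Point) : Set where
  x = proj₁ p
  y = proj₂ p
  z = (1ℤ + ρ) * x - y
  field
    x≥0 : 0ℤ ℤ.≤ x
    x<N : 0ℤ ℤ.< N - x
    y≥0 : 0ℤ ℤ.≤ y
    y<M : 0ℤ ℤ.< ρ * N - y
    z≥0 : 0ℤ ℤ.≤ z
    z<N : 0ℤ ℤ.< N - z

  N-pos : 0ℤ ℤ.< N
  N-pos = subst (0ℤ ℤ.<_) (identity N x) (pos-+-nonneg x<N x≥0)
    where
    identity : ∀ N x → N - x + x ≡ N
    identity = solve-∀

  M-pos : 0ℤ ℤ.< ρ * N
  M-pos = subst (0ℤ ℤ.<_) (identity ρ N y) (pos-+-nonneg y<M y≥0)
    where
    identity : ∀ ρ N y → ρ * N - y + y ≡ ρ * N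
    identity = solve-∀

-- For N = 4 ^ ρ and r = ρ + 1 this is the vector (`δ r` , `δ′ r`).
levelShift : ℤ → ℤ → Point
levelShift ρ N = + 3 * N , (+ 3 * ρ + + 4) * N

-- Raising ρ by one adds x to z, and the new z stays below 2N.
Box-grow : ∀ {ρ N p} → Box ρ N p → Box (1ℤ + ρ) (+ 4 * N) p
Box-grow {ρ} {N} {x , y} box = record
  { x≥0 = x≥0
  ; x<N = subst (0ℤ ℤ.<_) (x<N-id x N) (pos-+ x<N (pos-* {+ 3} (ℤ.positive⁻¹ (+ 3)) N-pos))
  ; y≥0 = y≥0
  ; y<M = subst (0ℤ ℤ.<_) (y<M-id y ρ N)
            (pos-+ y<M 3M+4N-pos)
  ; z≥0 = subst (0ℤ ℤ.≤_) (z≥0-id x y ρ) (nonneg-+ z≥0 x≥0)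
  ; z<N = subst (0ℤ ℤ.<_) (z<N-id x y ρ N) (pos-+ z<N (pos-+ x<N (pos-+ N-pos N-pos)))
  }
  where
  open Box box hiding (x; y; z)
  3M+4N-pos : 0ℤ ℤ.< + 3 * (ρ * N) + + 4 * N
  3M+4N-pos = pos-+ (pos-* {+ 3} (ℤ.positive⁻¹ (+ 3)) M-pos) (pos-* {+ 4} (ℤ.positive⁻¹ (+ 4)) N-pos)
  x<N-id : ∀ x N → N - x + + 3 * N ≡ + 4 * N - x
  x<N-id = solve-∀
  y<M-id : ∀ y ρ N → ρ * N - y + (+ 3 * (ρ * N) + + 4 * N) ≡ (1ℤ + ρ) * (+ 4 * N) - y
  y<M-id = solve-∀
  z≥0-id : ∀ x y ρ → (1ℤ + ρ) * x - y + x ≡ (1ℤ + (1ℤ + ρ)) * x - y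
  z≥0-id = solve-∀
  z<N-id : ∀ x y ρ N → N - ((1ℤ + ρ) * x - y) + (N - x + (N + N)) ≡ + 4 * N - ((1ℤ + (1ℤ + ρ)) * x - y)
  z<N-id = solve-∀

-- The factor 4 fits exactly: x stays below N + 3N and y below ρN + (3ρ + 4)N = (1 + ρ)4N. The new z
-- is z + x + 2N.
Box-shift : ∀ {ρ N p} → Box ρ N p → Box (1ℤ + ρ) (+ 4 * N) (p ⊕ levelShift ρ N)
Box-shift {ρ} {N} {x , y} box = record
  { x≥0 = nonneg-+ x≥0 (ℤ.<⇒≤ (pos-* {+ 3} (ℤ.positive⁻¹ (+ 3)) N-pos))
  ; x<N = subst (0ℤ ℤ.<_) (x<N-id x N) x<N
  ; y≥0 = nonneg-+ y≥0 (subst (0ℤ ℤ.≤_) (y≥0-id ρ N)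
            (ℤ.<⇒≤ 3M+4N-pos))
  ; y<M = subst (0ℤ ℤ.<_) (y<M-id y ρ N) y<M
  ; z≥0 = subst (0ℤ ℤ.≤_) (z≥0-id x y ρ N) (nonneg-+ z≥0 (nonneg-+ x≥0 (ℤ.<⇒≤ (pos-+ N-pos N-pos))))
  ; z<N = subst (0ℤ ℤ.<_) (z<N-id x y ρ N) (pos-+ z<N x<N)
  }
  where
  open Box box hiding (x; y; z)
  3M+4N-pos : 0ℤ ℤ.< + 3 * (ρ * N) + + 4 * N
  3M+4N-pos = pos-+ (pos-* {+ 3} (ℤ.positive⁻¹ (+ 3)) M-pos) (pos-* {+ 4} (ℤ.positive⁻¹ (+ 4)) N-pos)
  x<N-id : ∀ x N → N - x ≡ + 4 * N - (x + + 3 * N)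
  x<N-id = solve-∀
  y≥0-id : ∀ ρ N → + 3 * (ρ * N) + + 4 * N ≡ (+ 3 * ρ + + 4) * N
  y≥0-id = solve-∀
  y<M-id : ∀ y ρ N → ρ * N - y ≡ (1ℤ + ρ) * (+ 4 * N) - (y + (+ 3 * ρ + + 4) * N)
  y<M-id = solve-∀
  z≥0-id : ∀ x y ρ N → (1ℤ + ρ) * x - y + (x + (N + N)) ≡
    (1ℤ + (1ℤ + ρ)) * (x + + 3 * N) - (y + (+ 3 * ρ + + 4) * N)
  z≥0-id = solve-∀
  z<N-id : ∀ x y ρ N → N - ((1ℤ + ρ) * x - y) + (N - x) ≡
    + 4 * N - ((1ℤ + (1ℤ + ρ)) * (x + + 3 * N) - (y + (+ 3 * ρ + + 4) * N))
  z<N-id = solve-∀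

Box-origin : ∀ {ρ N} → 0ℤ ℤ.< ρ → 0ℤ ℤ.< N → Box ρ N origin
Box-origin {ρ} {N} 0<ρ 0<N = record
  { x≥0 = ℤ.≤-refl
  ; x<N = subst (0ℤ ℤ.<_) (sym (ℤ.+-identityʳ N)) 0<N
  ; y≥0 = ℤ.≤-refl
  ; y<M = subst (0ℤ ℤ.<_) (sym (ℤ.+-identityʳ (ρ * N))) (pos-* 0<ρ 0<N)
  ; z≥0 = subst (0ℤ ℤ.≤_) (sym (z≡0 ρ)) ℤ.≤-refl
  ; z<N = subst (λ z → 0ℤ ℤ.< N - z) (sym (z≡0 ρ)) (subst (0ℤ ℤ.<_) (sym (ℤ.+-identityʳ N)) 0<N)
  }
  where
  z≡0 : ∀ ρ → (1ℤ + ρ) * 0ℤ - 0ℤ ≡ 0ℤ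
  z≡0 = solve-∀

module _ {ρ N a b} (boxA : Box ρ N a) (boxB : Box ρ N b) where
  private
    module A = Box boxA
    module B = Box boxB

  cross-Δx : 0ℤ ℤ.< Δx a (b ⊕ levelShift ρ N)
  cross-Δx = subst (0ℤ ℤ.<_) (identity (proj₁ a) (proj₁ b) N)
    (pos-+ (pos-+-nonneg A.x<N B.x≥0) (pos-+ A.N-pos A.N-pos))
    where
    identity : ∀ a b N → N - a + b + (N + N) ≡ b + + 3 * N - a
    identity = solve-∀

  -- On the shift, (1 + ρ)x - y takes the value -N, so the excess is N minus the z of `b` plus the z
  -- of `a`.
  cross-above : SlopeAbove (1ℤ + ρ) a (b ⊕ levelShift ρ N)
  cross-above = mkAbove cross-Δx (subst (0ℤ ℤ.<_)
    (identity (proj₁ a) (proj₂ a) (proj₁ b) (proj₂ b) ρ N) (pos-+-nonneg B.z<N A.z≥0))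
    where
    identity : ∀ a a′ b b′ ρ N → N - ((1ℤ + ρ) * b - b′) + ((1ℤ + ρ) * a - a′) ≡
      b′ + (+ 3 * ρ + + 4) * N - a′ - (1ℤ + ρ) * (b + + 3 * N - a)
    identity = solve-∀

  -- On the shift, (2 + ρ)x - y takes the value 2N, while on a box it is z + x, which lies in [0,
  -- 2N).
  cross-below : SlopeBelow (1ℤ + (1ℤ + ρ)) a (b ⊕ levelShift ρ N)
  cross-below = mkBelow cross-Δx (subst (0ℤ ℤ.<_)
    (identity (proj₁ a) (proj₂ a) (proj₁ b) (proj₂ b) ρ N)
    (pos-+ (pos-+-nonneg A.z<N B.z≥0) (pos-+-nonneg A.x<N B.x≥0)))
    where
    identity : ∀ a a′ b b′ ρ N → N - ((1ℤ + ρ) * a - a′) + ((1ℤ + ρ) * b - b′) + (N - a + b) ≡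
      (1ℤ + (1ℤ + ρ)) * (b + + 3 * N - a) - (b′ + (+ 3 * ρ + + 4) * N - a′)
    identity = solve-∀

  cross-steep : 0ℤ ℤ.≤ ρ → Steep (1ℤ + (1ℤ + ρ)) a (b ⊕ levelShift ρ N)
  cross-steep 0≤ρ = mkAbove cross-Δx (subst (0ℤ ℤ.<_)
    (identity ρ (Δx a (b ⊕ levelShift ρ N)) (Δy a (b ⊕ levelShift ρ N)))
    (pos-+-nonneg (SlopeAbove.excess cross-above) (nonneg-* 0≤ρ (ℤ.<⇒≤ cross-Δx)))) , cross-below
    where
    identity : ∀ ρ x y → y - (1ℤ + ρ) * x + ρ * x ≡ y - 1ℤ * x
    identity = solve-∀

-- Cups, caps and polygons in the sets `S k l`.

-- Indices are counted from 2: this is ρ = k′ + l′ - 1 for k′ = 2 + k and l′ = 2 + l.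
level : ℕ → ℕ → ℕ
level k l = 3 ℕ.+ (k ℕ.+ l)

4^_ : ℕ → ℤ
4^ n = + (4 ^ n)

-- Both parts have the same level ρ, one below the level of the whole, and the shift has r = ρ + 1.
-- The box estimates apply in this form.
S-∪ : ∀ k l → let ρ = level k (suc l) in
  S (3 ℕ.+ k) (3 ℕ.+ l) ⊆
  S (2 ℕ.+ k) (3 ℕ.+ l) ∪ translate (levelShift (+ ρ) (4^ ρ)) (S (3 ℕ.+ k) (2 ℕ.+ l))
S-∪ k l = Sum.map₂ λ { (a , Sa , refl) → a , Sa , cong (a ⊕_) (cong₂ _,_ δ≡ δ′≡) }
  where
  ρ = level k (suc l)
  r = (3 ℕ.+ k) ℕ.+ (3 ℕ.+ l) ∸ 1
  r≡ : r ≡ suc ρ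
  r≡ = cong (2 ℕ.+_) (trans (ℕ.+-suc k (2 ℕ.+ l)) (cong suc (ℕ.+-suc k (suc l))))
  δ≡ : + δ r ≡ + 3 * 4^ ρ
  δ≡ = trans (cong (+_ ∘ δ) r≡) (ℤ.pos-* 3 (4 ^ ρ))
  δ′≡ : + δ′ r ≡ (+ 3 * + ρ + + 4) * 4^ ρ
  δ′≡ = trans (cong (+_ ∘ δ′) r≡) (trans (ℤ.pos-* (3 ℕ.* suc ρ ℕ.+ 1) (4 ^ ρ)) (cong (_* 4^ ρ)
    (trans (ℤ.pos-+ (3 ℕ.* suc ρ) 1) (trans (cong (_+ 1ℤ) (ℤ.pos-* 3 (suc ρ))) (identity (+ ρ))))))
    where
    identity : ∀ ρ → + 3 * (1ℤ + ρ) + 1ℤ ≡ + 3 * ρ + + 4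
    identity = solve-∀

level-suc : ∀ k l → level (suc k) l ≡ level k (suc l)
level-suc k l = cong (3 ℕ.+_) (sym (ℕ.+-suc k l))

InBox : ℕ → Pred Point 0ℓ
InBox n = Box (+ n) (4^ n)

InBox-suc : ∀ {n p} → Box (1ℤ + + n) (+ 4 * 4^ n) p → InBox (suc n) p
InBox-suc {n} {p} = subst (λ N → Box (+ suc n) N p) (sym (ℤ.pos-* 4 (4 ^ n)))

InBox-origin : ∀ n → InBox (suc n) origin
InBox-origin n = Box-origin (ℤ.+<+ (s≤s z≤n)) (ℤ.+<+ (ℕ.m^n>0 4 (suc n)))

S⊆Box : ∀ k l → S (2 ℕ.+ k) (2 ℕ.+ l) ⊆ InBox (level k l)
S⊆Box zero    l       refl = InBox-origin _
S⊆Box (suc k) zero    refl = InBox-origin _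
S⊆Box (suc k) (suc l) Sp with S-∪ k l Sp
... | inj₁ Sp             = InBox-suc (Box-grow (S⊆Box k (suc l) Sp))
... | inj₂ (p , Sp , refl) = InBox-suc (Box-shift (subst (λ n → InBox n p) (level-suc k l) (S⊆Box (suc k) l Sp)))

module _ (k l : ℕ) where
  private
    ρ = level k (suc l)
    A = S (2 ℕ.+ k) (3 ℕ.+ l)
    B = translate (levelShift (+ ρ) (4^ ρ)) (S (3 ℕ.+ k) (2 ℕ.+ l))

  boxA : A ⊆ InBox ρ
  boxA = S⊆Box k (suc l)

  boxB : S (3 ℕ.+ k) (2 ℕ.+ l) ⊆ InBox ρ
  boxB {p} Sp = subst (λ n → InBox n p) (level-suc k l) (S⊆Box (suc k) l Sp)

S-comparable : ∀ k l → Comparable (1ℤ + + level k l) (S (2 ℕ.+ k) (2 ℕ.+ l))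
S-comparable zero    l       refl refl = inj₁ refl
S-comparable (suc k) zero    refl refl = inj₁ refl
S-comparable (suc k) (suc l) Sa Sb = Comparable-∪
  (Comparable-suc (S-comparable k (suc l)))
  (Comparable-suc (Comparable-translate _
    (subst (λ n → Comparable (1ℤ + + n) (S (3 ℕ.+ k) (2 ℕ.+ l))) (level-suc k l) (S-comparable (suc k) l))))
  (λ { Aa (b , Bb , refl) → cross-steep (boxA k l Aa) (boxB k l Bb) (ℤ.+≤+ z≤n) })
  (S-∪ k l Sa) (S-∪ k l Sb)

-- Slopes between the parts exceed 1 + ρ and slopes inside them do not reach it. So the translate
-- lies above all lines of the first part, which lies below all lines of the translate.
S-separated : ∀ k l → let ρ = level k (suc l) in
  Separated _<ˣ_ (S (2 ℕ.+ k) (3 ℕ.+ l)) (translate (levelShift (+ ρ) (4^ ρ)) (S (3 ℕ.+ k) (2 ℕ.+ l)))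
S-separated k l = record
  -- The first part has x < N and the translate has x ≥ 3N, where N = 4 ^ ρ.
  { side     = λ p → proj₁ p ℤ.< 4^ ρ
  ; side?    = λ p → proj₁ p ℤ.<? 4^ ρ
  ; A⊆side   = λ Aa → pos⇒< (Box.x<N (boxA k l Aa))
  ; B⊆∁side  = λ { (b , Bb , refl) x<N → ℤ.<-asym x<N (pos⇒< (far (boxB k l Bb))) }
  ; precedes = inj₁ λ Aa Bb → SlopeAbove⇒<ˣ (cross Aa Bb)
  ; connexA  = comparable-connex cmpA
  ; connexB  = comparable-connex cmpB
  ; leftA    = λ Aa Aa′ Bb a<a′ → left-turn (proj₂ (comparable-steep cmpA Aa Aa′ a<a′)) (cross Aa′ Bb)
  ; leftB    = λ Bb Bb′ Aa b′<b → right-turn (cross Aa Bb′) (proj₂ (comparable-steep cmpB Bb′ Bb b′<b))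
  }
  where
  ρ = level k (suc l)
  A = S (2 ℕ.+ k) (3 ℕ.+ l)
  B = translate (levelShift (+ ρ) (4^ ρ)) (S (3 ℕ.+ k) (2 ℕ.+ l))
  far : ∀ {b} → InBox ρ b → 0ℤ ℤ.< proj₁ b + + 3 * 4^ ρ - 4^ ρ
  far {b} box = subst (0ℤ ℤ.<_) (identity (proj₁ b) (4^ ρ))
    (pos-+-nonneg (pos-+ (Box.N-pos box) (Box.N-pos box)) (Box.x≥0 box))
    where
    identity : ∀ b N → N + N + b ≡ b + + 3 * N - N
    identity = solve-∀
  cross : ∀ {a b} → A a → B b → SlopeAbove (1ℤ + + ρ) a b
  cross Aa (b , Bb , refl) = cross-above (boxA k l Aa) (boxB k l Bb)
  cmpA : Comparable (1ℤ + + ρ) A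
  cmpA = S-comparable k (suc l)
  cmpB : Comparable (1ℤ + + ρ) B
  cmpB = Comparable-translate _
    (subst (λ n → Comparable (1ℤ + + n) (S (3 ℕ.+ k) (2 ℕ.+ l))) (level-suc k l) (S-comparable (suc k) l))

-- A cup that meets the first part has at most one point in the translate.
S-cup-bound : ∀ k l → Bounded Cup (S (2 ℕ.+ k) (2 ℕ.+ l)) (suc k)
S-cup-bound zero    l       = Bounded-｛｝ (ℤ.<-irrefl refl)
S-cup-bound (suc k) zero    = Bounded-｛｝ (ℤ.<-irrefl refl)
S-cup-bound (suc k) (suc l) = Bounded-⊆ {Cup} (S-∪ k l) (chain-∪-bound ℤ.<-asym (S-separated k l)
  (S-cup-bound k (suc l)) (Bounded-translate {Cup} _ Cup-translation (S-cup-bound (suc k) l)))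

-- The parts change roles: a cap that meets the translate has at most one point in the first part.
S-cap-bound : ∀ k l → Bounded Cap (S (2 ℕ.+ k) (2 ℕ.+ l)) (suc l)
S-cap-bound zero    l       = Bounded-｛｝ (ℤ.<-irrefl refl)
S-cap-bound (suc k) zero    = Bounded-｛｝ (ℤ.<-irrefl refl)
S-cap-bound (suc k) (suc l) = Bounded-⊆ {Cap} (Sum.swap ∘ S-∪ k l)
  (chain-∪-bound ℤ.<-asym (Separated-flip (S-separated k l))
  (Bounded-translate {Cap} _ Cap-translation (S-cap-bound (suc k) l)) (S-cap-bound k (suc l)))

singleton-polygon : ∀ {p m} → Bounded Polygon ｛ p ｝ (suc m)
singleton-polygon {L = []}        _                 _                   = z≤n
singleton-polygon {L = _ ∷ []}    _                 _                   = s≤s z≤n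
singleton-polygon {L = _ ∷ _ ∷ _} (refl ∷ refl ∷ _) ((≢ ∷ _) ∷ _ , _) = contradiction refl ≢

S-polygon-bound : ∀ k l → Bounded Polygon (S (2 ℕ.+ k) (2 ℕ.+ l)) (suc (k ℕ.+ l))
S-polygon-bound zero    l       = singleton-polygon
S-polygon-bound (suc k) zero    = singleton-polygon
S-polygon-bound (suc k) (suc l) = Bounded-⊆ {Polygon} (S-∪ k l) (polygon-∪-bound (S-separated k l)
  (S-cup-bound k (suc l)) (Bounded-translate {Cap} _ Cap-translation (S-cap-bound (suc k) l))
  -- Cups and caps give (k + 1) + (l + 1), and the two polygon bounds below also give k + l + 2; the
  -- bound to be reached is k + l + 3.
  (ℕ.n≤1+n _)
  (Bounded-≤ {Polygon} (s≤s (ℕ.n≤1+n _)) (S-polygon-bound k (suc l)))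
  (Bounded-translate {Polygon} _ Polygon-translation
    (Bounded-≤ {Polygon} (s≤s (ℕ.+-monoʳ-≤ (suc k) (ℕ.n≤1+n l))) (S-polygon-bound (suc k) l))))

-- Arrangement of the blocks

linear : ℤ → ℤ → Point → ℤ
linear α β (x , y) = α * x + β * y

-- A functional with Q > 0 that is larger at `b` than at `a` and `d` puts `b` above the chord: the
-- slope exceeds -P/Q before `b` and is less than -P/Q after it.
right-turn-support : ∀ {P Q a b d} → 0ℤ ℤ.< Q → 0ℤ ℤ.< Δx a b → 0ℤ ℤ.< Δx b d →
  0ℤ ℤ.< linear P Q b - linear P Q a → 0ℤ ℤ.< linear P Q b - linear P Q d → Left d b a
right-turn-support {P} {Q} {a , a′} {b , b′} {d , d′} 0<Q ab bd a<b d<b =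
  mkLeft (*-cancel-pos 0<Q (subst (0ℤ ℤ.<_) (identity a a′ b b′ d d′ P Q)
    (pos-+ (pos-* bd a<b) (pos-* ab d<b))))
  where
  identity : ∀ a a′ b b′ d d′ P Q →
    (d - b) * (P * b + Q * b′ - (P * a + Q * a′)) + (b - a) * (P * b + Q * b′ - (P * d + Q * d′)) ≡
    Q * ((b - d) * (a′ - d′) - (b′ - d′) * (a - d))
  identity = solve-∀

-- The increments telescope; there is at least one, each is at least `c`, and `c` is nonnegative.
step-gap : ∀ {c} (F : ℕ → ℤ) → 0ℤ ℤ.≤ c → ∀ {h j} → h ℕ.< j →
  (∀ {a} → h ≤ a → a ℕ.< j → 0ℤ ℤ.≤ F (suc a) - F a - c) → 0ℤ ℤ.≤ F j - F h - c
step-gap {c} F 0≤c {h} {suc j} h<1+j steps with ℕ.m≤n⇒m<n∨m≡n (ℕ.s≤s⁻¹ h<1+j)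
... | inj₂ refl = steps ℕ.≤-refl ℕ.≤-refl
... | inj₁ h<j  = subst (0ℤ ℤ.≤_) (identity (F (suc j)) (F j) (F h) c)
  (nonneg-+
    (nonneg-+
      (steps (ℕ.<⇒≤ h<j) ℕ.≤-refl)
      (step-gap F 0≤c h<j (λ h≤a a<j → steps h≤a (ℕ.m<n⇒m<1+n a<j))))
    0≤c)
  where
  identity : ∀ f g h c → f - g - c + (g - h - c) + c ≡ f - h - c
  identity = solve-∀

linear-gap : ∀ t {c} α β → 0ℤ ℤ.≤ c → ∀ {h j} → h ℕ.< j →
  (∀ {a} → h ≤ a → a ℕ.< j → 0ℤ ℤ.≤ linear α β (v t a) - c) →
  0ℤ ℤ.≤ linear α β (w t j) - linear α β (w t h) - c
linear-gap t {c} α β 0≤c h<j steps = step-gap (linear α β ∘ w t) 0≤c h<j λ {a} h≤a a<j →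
  subst (0ℤ ℤ.≤_) (identity α β (proj₁ (w t a)) (proj₂ (w t a)) (proj₁ (v t a)) (proj₂ (v t a)) c)
    (steps h≤a a<j)
  where
  identity : ∀ α β x y x′ y′ c → α * x′ + β * y′ - c ≡ α * (x + x′) + β * (y + y′) - (α * x + β * y) - c
  identity = solve-∀

-- With t = 2 + u and i ≤ u, this writes t - i as 2 + (u - i), the form in which the bounds for `S`
-- are stated.
Block : ℕ → ℕ → Pred Point 0ℓ
Block u i = translate (q (2 ℕ.+ u) i) (S (2 ℕ.+ (u ∸ i)) (2 ℕ.+ i))

module _ (u : ℕ) where
  t : ℕ
  t = 2 ℕ.+ u

  private
    τ N M : ℤ
    τ = + t
    N = 4^ (1 ℕ.+ t)
    -- The scaling factor in `q`, and also the height ρN of a box with ρ = 1 + t.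
    M = + (1 ℕ.+ t) * N

  center : ℕ → Point
  center i = M ⊙ w t i

  -- All blocks have level 3 + (u - i) + i = 1 + t, so boxes of one size contain them, and blocks
  -- are compared through these boxes.
  NearCenter : ℕ → Pred Point 0ℓ
  NearCenter i = translate (center i) (InBox (1 ℕ.+ t))

  Block⊆NearCenter : ∀ {i} → i ≤ u → Block u i ⊆ NearCenter i
  Block⊆NearCenter {i} i≤u (a , Sa , refl) =
    a ,
    subst (λ n → InBox n a) (cong (3 ℕ.+_) (ℕ.m∸n+n≡m i≤u)) (S⊆Box (u ∸ i) i Sa) ,
    cong (λ M → a ⊕ M ⊙ w t i) M≡
    where
    M≡ : + ((t ℕ.+ 1) ℕ.* 4 ^ (t ℕ.+ 1)) ≡ M
    M≡ = trans (cong (λ n → + (n ℕ.* 4 ^ n)) (ℕ.+-comm t 1)) (ℤ.pos-* (1 ℕ.+ t) (4 ^ (1 ℕ.+ t)))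

  N-pos : 0ℤ ℤ.< N
  N-pos = Box.N-pos (InBox-origin t)

  M-pos : 0ℤ ℤ.< M
  M-pos = Box.M-pos (InBox-origin t)

  τ-pos : 0ℤ ℤ.< τ
  τ-pos = ℤ.+<+ (s≤s z≤n)

  M-N≥0 : 0ℤ ℤ.≤ M - N
  M-N≥0 = subst (0ℤ ℤ.≤_) (identity τ N) (nonneg-* (ℤ.<⇒≤ τ-pos) (ℤ.<⇒≤ N-pos))
    where
    identity : ∀ τ N → τ * N ≡ (1ℤ + τ) * N - N
    identity = solve-∀

  ℕ-diff-nonneg : ∀ {m n} → m ≤ n → 0ℤ ℤ.≤ + n - + m
  ℕ-diff-nonneg m≤n = ℤ.i≤j⇒0≤j-i (ℤ.+≤+ m≤n)

  -- The functionals x and x - y grow by at least 3 along each step of w.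
  near-Δx : ∀ {h j a b} → h ℕ.< j → j ≤ t → NearCenter h a → NearCenter j b → 0ℤ ℤ.< Δx a b
  near-Δx {h} {j} h<j j≤t (a , boxa , refl) (b , boxb , refl) =
    subst (0ℤ ℤ.<_) (identity (proj₁ a) (proj₁ b) (proj₁ (w t h)) (proj₂ (w t h)) (proj₁ (w t j)) (proj₂ (w t j)) N M)
      (pos-+-nonneg (pos-+-nonneg (pos-+ (pos-+-nonneg A.x<N B.x≥0) (pos-+ M-pos M-pos)) M-N≥0)
        (nonneg-* (ℤ.<⇒≤ M-pos) gap))
    where
    module A = Box boxa
    module B = Box boxb
    identity : ∀ a b x y x′ y′ N M →
      N - a + b + (M + M) + (M - N) + M * (1ℤ * x′ + 0ℤ * y′ - (1ℤ * x + 0ℤ * y) - + 3) ≡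
      b + M * x′ - (a + M * x)
    identity = solve-∀
    step : ∀ τ i → + 3 * (τ - (1ℤ + i)) ≡ 1ℤ * (+ 3 * (τ - i)) + 0ℤ * (- (+ 3 * i)) - + 3
    step = solve-∀
    gap : 0ℤ ℤ.≤ linear 1ℤ 0ℤ (w t j) - linear 1ℤ 0ℤ (w t h) - + 3
    gap = linear-gap t 1ℤ 0ℤ (ℤ.+≤+ z≤n) h<j λ {i} _ i<j →
      subst (0ℤ ℤ.≤_) (step τ (+ i)) (nonneg-* {+ 3} (ℤ.+≤+ z≤n) (ℕ-diff-nonneg (ℕ.≤-trans i<j j≤t)))

  -- The centers differ by at least 3M in x - y; the positions inside the boxes take back less than
  -- N + M.
  near-below : ∀ {h j a b} → h ℕ.< j → j ≤ t → NearCenter h a → NearCenter j b → SlopeBelow 1ℤ a b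
  near-below {h} {j} h<j j≤t Na@(a , boxa , refl) Nb@(b , boxb , refl) = mkBelow (near-Δx h<j j≤t Na Nb)
    (subst (0ℤ ℤ.<_)
      (identity (proj₁ a) (proj₂ a) (proj₁ b) (proj₂ b)
        (proj₁ (w t h)) (proj₂ (w t h)) (proj₁ (w t j)) (proj₂ (w t j)) N M)
      (pos-+-nonneg (pos-+-nonneg (pos-+ (pos-+ (pos-+-nonneg A.x<N B.x≥0) (pos-+-nonneg B.y<M A.y≥0)) M-pos) M-N≥0)
        (nonneg-* (ℤ.<⇒≤ M-pos) gap)))
    where
    module A = Box boxa
    module B = Box boxb
    identity : ∀ a a′ b b′ x y x′ y′ N M →
      N - a + b + (M - b′ + a′) + M + (M - N) + M * (1ℤ * x′ + - 1ℤ * y′ - (1ℤ * x + - 1ℤ * y) - + 3) ≡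
      1ℤ * (b + M * x′ - (a + M * x)) - (b′ + M * y′ - (a′ + M * y))
    identity = solve-∀
    step : ∀ u i → + 3 * (1ℤ + u) ≡ 1ℤ * (+ 3 * (+ 2 + u - i)) + - 1ℤ * (- (+ 3 * i)) - + 3
    step = solve-∀
    gap : 0ℤ ℤ.≤ linear 1ℤ (- 1ℤ) (w t j) - linear 1ℤ (- 1ℤ) (w t h) - + 3
    gap = linear-gap t 1ℤ (- 1ℤ) (ℤ.+≤+ z≤n) h<j λ {i} _ i<j →
      subst (0ℤ ℤ.≤_) (step (+ u) (+ i)) (ℤ.+≤+ z≤n)

  module _ (j : ℕ) (1≤j : 1 ≤ j) (j≤t : j ≤ t) where
    private
      P Q : ℤ
      -- Three times (Q , - P) is the sum of `v t (j - 1)` and `v t j`.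
      P = + 2 * + j - 1ℤ
      Q = + 2 * (τ - + j) + 1ℤ

    -- The slope - P / Q lies strictly between those of v (j - 1) and v j, so
    -- this functional is maximal at w j among all the w i.
    support : Point → ℤ
    support = linear P Q

    P≥0 : 0ℤ ℤ.≤ P
    P≥0 = subst (0ℤ ℤ.≤_) (identity (+ j))
      (nonneg-+ (nonneg-* {+ 2} (ℤ.+≤+ z≤n) (ℕ-diff-nonneg 1≤j)) (ℤ.+≤+ {0} {1} z≤n))
      where
      identity : ∀ j → + 2 * (j - 1ℤ) + 1ℤ ≡ + 2 * j - 1ℤ
      identity = solve-∀

    Q-pos : 0ℤ ℤ.< Q
    Q-pos = ℤ.+-mono-≤-< (nonneg-* {+ 2} (ℤ.+≤+ z≤n) (ℕ-diff-nonneg j≤t)) (ℤ.positive⁻¹ 1ℤ)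

    -- On `v t i` the functional equals 3t(2(j - i) - 1): at least 3t for i < j and at most -3t for
    -- i ≥ j.
    support-gap : ∀ {h} → h ≢ j → 0ℤ ℤ.≤ support (w t j) - support (w t h) - + 3 * τ
    support-gap {h} h≢j with ℕ.<-cmp h j
    ... | tri≈ _ h≡j _ = contradiction h≡j h≢j
    ... | tri< h<j _ _ = linear-gap t P Q (ℤ.+≤+ z≤n) h<j λ {i} _ i<j →
      subst (0ℤ ℤ.≤_) (step τ (+ j) (+ i)) (nonneg-* (nonneg-* {+ 6} (ℤ.+≤+ z≤n) (ℤ.<⇒≤ τ-pos)) (ℕ-diff-nonneg i<j))
      where
      step : ∀ τ j i → + 6 * τ * (j - (1ℤ + i)) ≡
        (+ 2 * j - 1ℤ) * (+ 3 * (τ - i)) + (+ 2 * (τ - j) + 1ℤ) * (- (+ 3 * i)) - + 3 * τ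
      step = solve-∀
    ... | tri> _ _ j<h = subst (0ℤ ℤ.≤_)
      (negate P Q (proj₁ (w t j)) (proj₂ (w t j)) (proj₁ (w t h)) (proj₂ (w t h)) (+ 3 * τ))
      (linear-gap t (- P) (- Q) (ℤ.+≤+ z≤n) j<h λ {i} j≤i _ →
        subst (0ℤ ℤ.≤_) (step τ (+ j) (+ i)) (nonneg-* (nonneg-* {+ 6} (ℤ.+≤+ z≤n) (ℤ.<⇒≤ τ-pos)) (ℕ-diff-nonneg j≤i)))
      where
      step : ∀ τ j i → + 6 * τ * (i - j) ≡
        - (+ 2 * j - 1ℤ) * (+ 3 * (τ - i)) + - (+ 2 * (τ - j) + 1ℤ) * (- (+ 3 * i)) - + 3 * τ
      step = solve-∀
      negate : ∀ P Q x y x′ y′ c → - P * x′ + - Q * y′ - (- P * x + - Q * y) - c ≡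
        P * x + Q * y - (P * x′ + Q * y′) - c
      negate = solve-∀

    -- The centers differ by at least 3tM. Positions inside the boxes cost at most PN + QM ≤ (P +
    -- Q)M = 2tM, which leaves tM.
    support-max : ∀ {h a b} → h ≢ j → NearCenter h a → NearCenter j b → 0ℤ ℤ.< support b - support a
    support-max {h} h≢j (a , boxa , refl) (b , boxb , refl) =
      subst (0ℤ ℤ.<_)
        (identity (proj₁ a) (proj₂ a) (proj₁ b) (proj₂ b)
          (proj₁ (w t h)) (proj₂ (w t h)) (proj₁ (w t j)) (proj₂ (w t j)) N M τ (+ j))
        (pos-+-nonneg (pos-* τ-pos M-pos)
          (nonneg-+ (nonneg-+ (nonneg-+
            (nonneg-* P≥0 (nonneg-+ (ℤ.<⇒≤ A.x<N) B.x≥0))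
            (nonneg-* (ℤ.<⇒≤ Q-pos) (nonneg-+ (ℤ.<⇒≤ A.y<M) B.y≥0)))
            (nonneg-* P≥0 M-N≥0))
            (nonneg-* (ℤ.<⇒≤ M-pos) (support-gap h≢j))))
      where
      module A = Box boxa
      module B = Box boxb
      identity : ∀ a a′ b b′ x y x′ y′ N M τ j →
        τ * M + ((+ 2 * j - 1ℤ) * (N - a + b) + (+ 2 * (τ - j) + 1ℤ) * (M - a′ + b′) + (+ 2 * j - 1ℤ) * (M - N)
          + M * ((+ 2 * j - 1ℤ) * x′ + (+ 2 * (τ - j) + 1ℤ) * y′
            - ((+ 2 * j - 1ℤ) * x + (+ 2 * (τ - j) + 1ℤ) * y) - + 3 * τ)) ≡
        (+ 2 * j - 1ℤ) * (b + M * x′) + (+ 2 * (τ - j) + 1ℤ) * (b′ + M * y′) -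
          ((+ 2 * j - 1ℤ) * (a + M * x) + (+ 2 * (τ - j) + 1ℤ) * (a′ + M * y))
      identity = solve-∀

    centers-cap : ∀ {h k a b d} → h ℕ.< j → j ℕ.< k → k ≤ t →
      NearCenter h a → NearCenter j b → NearCenter k d → Left d b a
    centers-cap h<j j<k k≤t Na Nb Nd = right-turn-support {P} {Q} Q-pos
      (near-Δx h<j j≤t Na Nb) (near-Δx j<k k≤t Nb Nd)
      (support-max (ℕ.<⇒≢ h<j) Na Nb) (support-max (ℕ.<⇒≢ j<k ∘ sym) Nd Nb)

  -- Bounds for the blocks and their unions.

  Block-comparable : ∀ i → Comparable (1ℤ + + level (u ∸ i) i) (Block u i)
  Block-comparable i = Comparable-translate _ (S-comparable (u ∸ i) i)

  Block-cup-bound : ∀ i → Bounded Cup (Block u i) (suc (u ∸ i))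
  Block-cup-bound i = Bounded-translate {Cup} _ Cup-translation (S-cup-bound (u ∸ i) i)

  Block-cap-bound : ∀ i → Bounded Cap (Block u i) (suc i)
  Block-cap-bound i = Bounded-translate {Cap} _ Cap-translation (S-cap-bound (u ∸ i) i)

  Block-polygon-bound : ∀ {i} → i ≤ u → Bounded Polygon (Block u i) (suc u)
  Block-polygon-bound {i} i≤u = Bounded-≤ {Polygon} (ℕ.≤-reflexive (cong suc (ℕ.m∸n+n≡m i≤u)))
    (Bounded-translate {Polygon} _ Polygon-translation (S-polygon-bound (u ∸ i) i))

  Blocks≤ : ℕ → Pred Point 0ℓ
  Blocks≤ j p = ∃[ i ] i ≤ j × Block u i p

  Blocks≤-zero : Blocks≤ 0 ⊆ Block u 0
  Blocks≤-zero (_ , z≤n , Bp) = Bp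

  Blocks≤-suc : ∀ j → Blocks≤ (suc j) ⊆ Blocks≤ j ∪ Block u (suc j)
  Blocks≤-suc j (i , i≤1+j , Bp) with ℕ.m≤n⇒m<n∨m≡n i≤1+j
  ... | inj₁ i<1+j = inj₁ (i , ℕ.s≤s⁻¹ i<1+j , Bp)
  ... | inj₂ refl  = inj₂ Bp

  module _ (j : ℕ) (j<u : suc j ≤ u) where
    private
      A B : Pred Point 0ℓ
      A = Blocks≤ j
      B = Block u (suc j)

    1+j≤t : suc j ≤ t
    1+j≤t = ℕ.≤-trans j<u (ℕ.m≤n+m u 2)

    i≤t : ∀ {i} → i ≤ j → i ≤ t
    i≤t i≤j = ℕ.≤-trans (ℕ.m≤n⇒m≤1+n i≤j) 1+j≤t

    nearA : ∀ {i a} → i ≤ j → Block u i a → NearCenter i a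
    nearA i≤j = Block⊆NearCenter (ℕ.≤-trans (ℕ.m≤n⇒m≤1+n i≤j) j<u)

    nearB : ∀ {b} → B b → NearCenter (suc j) b
    nearB = Block⊆NearCenter j<u

    cross-<ˣ : ∀ {a b} → A a → NearCenter (suc j) b → a <ˣ b
    cross-<ˣ (i , i≤j , Ba) Nb = pos⇒< (near-Δx (s≤s i≤j) 1+j≤t (nearA i≤j Ba) Nb)

    cross-SlopeBelow : ∀ {a b} → A a → B b → SlopeBelow 1ℤ a b
    cross-SlopeBelow (i , i≤j , Ba) Bb = near-below (s≤s i≤j) 1+j≤t (nearA i≤j Ba) (nearB Bb)

    -- A corner of the box around block j + 1; the vertical line through it has all earlier blocks
    -- strictly on its left.
    side-origin : Point
    side-origin = origin ⊕ center (suc j)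

    Blocks-connex : ∀ {a a′} → A a → A a′ → a ≢ a′ → a >ˣ a′ ⊎ a′ >ˣ a
    Blocks-connex (i , i≤j , Ba) (i′ , i′≤j , Ba′) a≢a′ with ℕ.<-cmp i i′
    ... | tri< i<i′ _ _ = inj₂ (pos⇒< (near-Δx i<i′ (i≤t i′≤j) (nearA i≤j Ba) (nearA i′≤j Ba′)))
    ... | tri> _ _ i′<i = inj₁ (pos⇒< (near-Δx i′<i (i≤t i≤j) (nearA i′≤j Ba′) (nearA i≤j Ba)))
    ... | tri≈ _ refl _ = Sum.swap (comparable-connex (Block-comparable i) Ba Ba′ a≢a′)

    -- Points of two different blocks and of block j + 1 inherit the cap position of their centers.
    -- Points of one block have slope above 1, whereas slopes to block j + 1 are below 1.
    Blocks-left : ∀ {a a′ b} → A a → A a′ → B b → a′ <ˣ a → Left a a′ b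
    Blocks-left {a} {a′} {b} Aa@(i , i≤j , Ba) (i′ , i′≤j , Ba′) Bb a′<a with ℕ.<-cmp i′ i
    ... | tri< i′<i _ _ = Left-cyclic {b} {a} {a′}
            (centers-cap i (ℕ.≤-trans (s≤s z≤n) i′<i) (i≤t i≤j) i′<i (s≤s i≤j) 1+j≤t
              (nearA i′≤j Ba′) (nearA i≤j Ba) (nearB Bb))
    ... | tri> _ _ i<i′ = contradiction a′<a
            (ℤ.<-asym (pos⇒< (near-Δx i<i′ (i≤t i′≤j) (nearA i≤j Ba) (nearA i′≤j Ba′))))
    ... | tri≈ _ refl _ = Left-cyclic {b} {a} {a′}
            (right-turn (proj₁ (comparable-steep (Block-comparable i) Ba′ Ba a′<a)) (cross-SlopeBelow Aa Bb))

    -- Block j + 1 lies below all lines through two earlier points, and the earlier points lie above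
    -- all lines of the block. Hence the order is reversed: `A` contributes caps and `B` cups.
    Blocks-separated : Separated _>ˣ_ A B
    Blocks-separated = record
      { side     = _<ˣ side-origin
      ; side?    = λ p → proj₁ p ℤ.<? proj₁ side-origin
      ; A⊆side   = λ Aa → cross-<ˣ Aa (origin , InBox-origin t , refl)
      ; B⊆∁side  = λ Bb b<side → ℤ.<⇒≱ b<side (right-of-side (nearB Bb))
      ; precedes = inj₂ λ Aa Bb → cross-<ˣ Aa (nearB Bb)
      ; connexA  = Blocks-connex
      ; connexB  = λ Bb Bb′ b≢b′ → Sum.swap (comparable-connex (Block-comparable (suc j)) Bb Bb′ b≢b′)
      ; leftA    = Blocks-left
      ; leftB    = λ {b} {b′} {a} Bb Bb′ Aa b<b′ → Left-cyclic {a} {b} {b′}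
          (left-turn (cross-SlopeBelow Aa Bb) (proj₁ (comparable-steep (Block-comparable (suc j)) Bb Bb′ b<b′)))
      }
      where
      right-of-side : ∀ {b} → NearCenter (suc j) b → proj₁ side-origin ℤ.≤ proj₁ b
      right-of-side (b , box , refl) = ℤ.+-monoˡ-≤ (proj₁ (center (suc j))) (Box.x≥0 box)

  -- A cap that meets the earlier blocks has at most one point in block j + 1, whose own caps have
  -- at most j + 2 points.
  Blocks≤-cap-bound : ∀ {j} → j ≤ u → Bounded Cap (Blocks≤ j) (suc j)
  Blocks≤-cap-bound {zero}  _   = Bounded-⊆ {Cap} Blocks≤-zero (Block-cap-bound 0)
  Blocks≤-cap-bound {suc j} j<u = Bounded-⊆ {Cap} (Blocks≤-suc j)
    (chain-∪-bound ℤ.<-asym (Blocks-separated j j<u)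
    (Blocks≤-cap-bound (ℕ.<⇒≤ j<u)) (Block-cap-bound (suc j)))

  Blocks≤-polygon-bound : ∀ {j} → j ≤ u → Bounded Polygon (Blocks≤ j) (suc u)
  Blocks≤-polygon-bound {zero}  _   = Bounded-⊆ {Polygon} Blocks≤-zero (Block-polygon-bound z≤n)
  Blocks≤-polygon-bound {suc j} j<u = Bounded-⊆ {Polygon} (Blocks≤-suc j)
    (polygon-∪-bound (Blocks-separated j j<u)
    (Blocks≤-cap-bound (ℕ.<⇒≤ j<u)) (Block-cup-bound (suc j))
    -- Caps of the blocks up to j and cups of block j + 1 together: (j + 1) + (u - (j + 1) + 1) = u
    -- + 1 = t - 1.
    (ℕ.≤-reflexive (trans (ℕ.+-suc (suc j) (u ∸ suc j)) (cong suc (ℕ.m+[n∸m]≡n j<u))))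
    (Blocks≤-polygon-bound (ℕ.<⇒≤ j<u)) (Block-polygon-bound j<u))

  ErdősSzekeresSet⊆Blocks≤ : ErdősSzekeresSet (2 ℕ.+ u) ⊆ Blocks≤ u
  ErdősSzekeresSet⊆Blocks≤ {p} (i , i≤u , Bp) = i , i≤u ,
    subst₂ (λ k l → translate (q (2 ℕ.+ u) i) (S k l) p) (ℕ.+-∸-assoc 2 i≤u) (ℕ.+-comm i 2) Bp

theorem3 : ∀ (t : ℕ) → 2 ≤ t → ∀ (n : ℕ) (P : Fin n → Point) →
    IsConvexPolygon P → (∀ i → ErdősSzekeresSet t (P i)) →
    n ≤ t ∸ 1
theorem3 1 (s≤s ())
theorem3 (suc (suc u)) _ n P polygon P∈S with polygon-list polygon
... | L , poly , |L|≡n , all =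
  subst (_≤ suc u) |L|≡n
    (Blocks≤-polygon-bound u ℕ.≤-refl (all (λ i → ErdősSzekeresSet⊆Blocks≤ u (P∈S i))) poly)
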